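{- Let $(P,\le)$ be a locally finite join-semilattice with bottom element, and let $\mu_P$ be its M\"obius function. Suppose that for every $y\in P$, there exist infinitely many $z\in P$ such that (i) $z$ covers $y$; and (ii) for all $x\le y$, $\mu_P(x,z)=\mu_P(x,y)\,\mu_P(y,z)=-\mu_P(x,y)$. Then for any $f:P\to\mathbb{C}$ that is not identically zero, the support of $f$ and the support of its M\"obius transform $g:P\to\mathbb{C}$, given by $g(y)=\sum_{x\le y} f(x)$ for all $y\in P$, cannot both be finite.
   Context: An interval in a poset $(P,\le)$ is a set $[x,y]=\{z\in P: x\le z\le y\}$ with $x\le y$ in $P$. The poset is locally finite if every interval is finite. A bottom element is an element $\widehat 0\in P$ with $\widehat 0\le x$ for all $x\in P$. The join $x\vee y$ of $x,y$ is their least upper bound; $P$ is a join-semilattice if every finite set of its elements has a join in $P$. An element $z$ covers $y$ if $y<z$ and $y\le z'<z$ implies $z'=y$. The M\"obius function $\mu_P$ is the function on intervals, written $\mu_P(x,y)=\mu_P([x,y])$ for $x\le y$, defined recursively by $\mu_P(x,x)=1$ for all $x\in P$ and $\mu_P(x,y)=-\sum_{x\le z<y}\mu_P(x,z)$ for all $x<y$ in $P$. The support of $f:P\to\mathbb{C}$ is $\{x\in P: f(x)\neq 0\}$. Since $P$ is locally finite with a bottom element, the set $\{x\in P: x\le y\}$ is finite for each $y$, so the sum defining $g$ is finite. -}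

module Defs where

open import Level using (Level; 0ℓ; _⊔_)
open import Algebra.Bundles using (CommutativeMonoid)
import Algebra.Construct.DirectProduct as DirectProduct
import Algebra.Properties.CommutativeMonoid.Sum as Sum
open import Data.Fin.Base as Fin using (Fin; punchIn; punchOut)
import Data.Fin.Properties as Fin
open import Data.Integer.Base as ℤ using (ℤ; 1ℤ)
import Data.Integer.Properties as ℤ
open import Data.Nat.Base as ℕ using (ℕ; zero; suc)
open import Data.Nat.Induction using (<-wellFounded)
import Data.Nat.Properties as ℕ
open import Data.Product.Base using (∃; _×_; _,_; proj₁; proj₂)
open import Data.Rational.Base as ℚ using (ℚ; 0ℚ; ½; ∣_∣)
import Data.Rational.Properties as ℚ
open import Data.Rational.Solver using (module +-*-Solver)
open import Function.Bundles using (Inverse; Injection)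
import Function.Construct.Composition as Compose
import Function.Construct.Symmetry as Symmetry
open import Function.Properties.Inverse using (Inverse⇒Injection)
open import Induction.WellFounded using (Acc; acc)
open import Relation.Binary.Bundles using (Setoid; Poset)
open import Relation.Binary.Core using (Rel)
open import Relation.Binary.Definitions using (Decidable)
open import Relation.Binary.Lattice.Bundles using (BoundedJoinSemilattice)
import Relation.Binary.Construct.On as On
import Relation.Binary.Properties.Poset as PosetProperties
open import Relation.Binary.PropositionalEquality as ≡
  using (_≡_; _≢_; refl; cong; subst)
open import Relation.Nullary using (¬_; Dec; yes; no; contradiction)
open import Relation.Nullary.Decidable using (via-injection)
open import Relation.Unary using (Pred)

private
  variable
    a b c ℓ ℓ₁ ℓ₂ p : Level

-- Real numbers are Cauchy sequences of rationals modulo null sequences.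
record ℝ : Set where
  constructor mkℝ
  field
    seq    : ℕ → ℚ
    cauchy : ∀ ε → 0ℚ ℚ.< ε →
             ∃ λ N → ∀ m n → N ℕ.≤ m → N ℕ.≤ n → ∣ seq m ℚ.- seq n ∣ ℚ.< ε

open ℝ

infix 4 _≈ᵣ_

_≈ᵣ_ : Rel ℝ 0ℓ
x ≈ᵣ y = ∀ ε → 0ℚ ℚ.< ε →
         ∃ λ N → ∀ n → N ℕ.≤ n → ∣ seq x n ℚ.- seq y n ∣ ℚ.< ε

private
  half-pos : ∀ {ε} → 0ℚ ℚ.< ε → 0ℚ ℚ.< ½ ℚ.* ε
  half-pos {ε} ε>0 =
    subst (ℚ._< ½ ℚ.* ε) (ℚ.*-zeroʳ ½) (ℚ.*-monoʳ-<-pos ½ ε>0)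

  half+half : ∀ ε → ½ ℚ.* ε ℚ.+ ½ ℚ.* ε ≡ ε
  half+half ε = ≡.trans (≡.sym (ℚ.*-distribʳ-+ ε ½ ½)) (ℚ.*-identityˡ ε)

  ∣+∣<ε : ∀ {u v ε} → ∣ u ∣ ℚ.< ½ ℚ.* ε → ∣ v ∣ ℚ.< ½ ℚ.* ε →
          ∣ u ℚ.+ v ∣ ℚ.< ε
  ∣+∣<ε {u} {v} {ε} ∣u∣< ∣v∣< = begin-strict
    ∣ u ℚ.+ v ∣            ≤⟨ ℚ.∣p+q∣≤∣p∣+∣q∣ u v ⟩
    ∣ u ∣ ℚ.+ ∣ v ∣        <⟨ ℚ.+-mono-< ∣u∣< ∣v∣< ⟩
    ½ ℚ.* ε ℚ.+ ½ ℚ.* ε    ≡⟨ half+half ε ⟩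
    ε                      ∎
    where open ℚ.≤-Reasoning

  rearrange : ∀ x y u v →
              (x ℚ.- u) ℚ.+ (y ℚ.- v) ≡ (x ℚ.+ y) ℚ.- (u ℚ.+ v)
  rearrange = solve 4 (λ x y u v →
      (x :- u) :+ (y :- v) := (x :+ y) :- (u :+ v)) refl
    where open +-*-Solver

  telescope : ∀ x y z → (x ℚ.- y) ℚ.+ (y ℚ.- z) ≡ x ℚ.- z
  telescope = solve 3 (λ x y z → (x :- y) :+ (y :- z) := x :- z) refl
    where open +-*-Solver

  negate : ∀ x y → ℚ.- (x ℚ.- y) ≡ y ℚ.- x
  negate = solve 2 (λ x y → :- (x :- y) := y :- x) refl
    where open +-*-Solver

  ∣x-x∣<ε : ∀ x {ε} → 0ℚ ℚ.< ε → ∣ x ℚ.- x ∣ ℚ.< ε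
  ∣x-x∣<ε x {ε} = subst (λ q → ∣ q ∣ ℚ.< ε) (≡.sym (ℚ.+-inverseʳ x))

  pointwise⇒≈ᵣ : ∀ x y → (∀ n → seq x n ≡ seq y n) → x ≈ᵣ y
  pointwise⇒≈ᵣ x y eq ε ε>0 = 0 , λ n _ →
    subst (λ q → ∣ seq x n ℚ.- q ∣ ℚ.< ε) (eq n) (∣x-x∣<ε (seq x n) ε>0)

infixl 6 _+ᵣ_

_+ᵣ_ : ℝ → ℝ → ℝ
x +ᵣ y = mkℝ (λ n → seq x n ℚ.+ seq y n) λ ε ε>0 →
  let N₁ , h₁ = cauchy x (½ ℚ.* ε) (half-pos ε>0)
      N₂ , h₂ = cauchy y (½ ℚ.* ε) (half-pos ε>0)
  in N₁ ℕ.⊔ N₂ , λ m n N≤m N≤n →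
     subst (λ q → ∣ q ∣ ℚ.< ε)
           (rearrange (seq x m) (seq y m) (seq x n) (seq y n))
           (∣+∣<ε (h₁ m n (ℕ.m⊔n≤o⇒m≤o N₁ N₂ N≤m) (ℕ.m⊔n≤o⇒m≤o N₁ N₂ N≤n))
                  (h₂ m n (ℕ.m⊔n≤o⇒n≤o N₁ N₂ N≤m) (ℕ.m⊔n≤o⇒n≤o N₁ N₂ N≤n)))

0ᵣ : ℝ
0ᵣ = mkℝ (λ _ → 0ℚ) λ ε ε>0 → 0 , λ _ _ _ _ → ∣x-x∣<ε 0ℚ ε>0

ℝ-+-commutativeMonoid : CommutativeMonoid 0ℓ 0ℓ
ℝ-+-commutativeMonoid = record
  { Carrier = ℝ
  ; _≈_     = _≈ᵣ_
  ; _∙_     = _+ᵣ_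
  ; ε       = 0ᵣ
  ; isCommutativeMonoid = record
    { isMonoid = record
      { isSemigroup = record
        { isMagma = record
          { isEquivalence = record
            { refl  = λ {x} → pointwise⇒≈ᵣ x x λ _ → refl
            ; sym   = λ {x} {y} → ≈-sym x y
            ; trans = λ {x} {y} {z} → ≈-trans x y z
            }
          ; ∙-cong = λ {x} {u} {y} {v} → ∙-cong x u y v
          }
        ; assoc = λ x y z → pointwise⇒≈ᵣ ((x +ᵣ y) +ᵣ z) (x +ᵣ (y +ᵣ z))
                    λ n → ℚ.+-assoc (seq x n) (seq y n) (seq z n)
        }
      ; identity =
          (λ x → pointwise⇒≈ᵣ (0ᵣ +ᵣ x) x λ n → ℚ.+-identityˡ (seq x n))
        , (λ x → pointwise⇒≈ᵣ (x +ᵣ 0ᵣ) x λ n → ℚ.+-identityʳ (seq x n))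
      }
    ; comm = λ x y → pointwise⇒≈ᵣ (x +ᵣ y) (y +ᵣ x)
               λ n → ℚ.+-comm (seq x n) (seq y n)
    }
  }
  where
  ≈-sym : ∀ x y → x ≈ᵣ y → y ≈ᵣ x
  ≈-sym x y x≈y ε ε>0 =
    let N , h = x≈y ε ε>0
    in N , λ n N≤n →
       subst (ℚ._< ε)
             (≡.trans (≡.sym (ℚ.∣-p∣≡∣p∣ (seq x n ℚ.- seq y n)))
                      (cong ∣_∣ (negate (seq x n) (seq y n))))
             (h n N≤n)

  ≈-trans : ∀ x y z → x ≈ᵣ y → y ≈ᵣ z → x ≈ᵣ z
  ≈-trans x y z x≈y y≈z ε ε>0 =
    let N₁ , h₁ = x≈y (½ ℚ.* ε) (half-pos ε>0)
        N₂ , h₂ = y≈z (½ ℚ.* ε) (half-pos ε>0)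
    in N₁ ℕ.⊔ N₂ , λ n N≤n →
       subst (λ q → ∣ q ∣ ℚ.< ε) (telescope (seq x n) (seq y n) (seq z n))
             (∣+∣<ε (h₁ n (ℕ.m⊔n≤o⇒m≤o N₁ N₂ N≤n))
                    (h₂ n (ℕ.m⊔n≤o⇒n≤o N₁ N₂ N≤n)))

  ∙-cong : ∀ x u y v → x ≈ᵣ u → y ≈ᵣ v → (x +ᵣ y) ≈ᵣ (u +ᵣ v)
  ∙-cong x u y v x≈u y≈v ε ε>0 =
    let N₁ , h₁ = x≈u (½ ℚ.* ε) (half-pos ε>0)
        N₂ , h₂ = y≈v (½ ℚ.* ε) (half-pos ε>0)
    in N₁ ℕ.⊔ N₂ , λ n N≤n →
       subst (λ q → ∣ q ∣ ℚ.< ε)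
             (rearrange (seq x n) (seq y n) (seq u n) (seq v n))
             (∣+∣<ε (h₁ n (ℕ.m⊔n≤o⇒m≤o N₁ N₂ N≤n))
                    (h₂ n (ℕ.m⊔n≤o⇒n≤o N₁ N₂ N≤n)))

-- Complex numbers are pairs (real part , imaginary part) with
-- componentwise equality and addition.  Möbius transforms and supports
-- involve no further structure, so multiplication is not defined.
ℂ-+-commutativeMonoid : CommutativeMonoid 0ℓ 0ℓ
ℂ-+-commutativeMonoid =
  DirectProduct.commutativeMonoid ℝ-+-commutativeMonoid ℝ-+-commutativeMonoid

ℂ-setoid : Setoid 0ℓ 0ℓ
ℂ-setoid = CommutativeMonoid.setoid ℂ-+-commutativeMonoid

open CommutativeMonoid ℂ-+-commutativeMonoid public
  using () renaming (Carrier to ℂ; _≈_ to _≈ᶜ_; ε to 0ᶜ)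

record Finite (S : Setoid a ℓ) : Set (a ⊔ ℓ) where
  field
    size        : ℕ
    enumeration : Inverse S (≡.setoid (Fin size))

  open Setoid S using (Carrier; _≈_)
  open Inverse enumeration public
    using () renaming (to to index; from to element)

  infix 4 _≟_
  _≟_ : Decidable _≈_
  _≟_ = via-injection (Inverse⇒Injection enumeration) Fin._≟_

open Finite using (size)

Infinite : Setoid a ℓ → Set (a ⊔ ℓ)
Infinite S = ¬ Finite S

-- The subset { x ∈ S | P x }.  Equality of its elements ignores the
-- proofs of P.
subset : (S : Setoid a ℓ) → Pred (Setoid.Carrier S) p → Setoid (a ⊔ p) ℓ
subset S P = On.setoid {B = ∃ P} S proj₁

∑ : (M : CommutativeMonoid c ℓ₁) {S : Setoid a ℓ₂} → Finite S →
    (Setoid.Carrier S → CommutativeMonoid.Carrier M) →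
    CommutativeMonoid.Carrier M
∑ M fin h = Sum.sum M λ i → h (Finite.element fin i)

transport : {S : Setoid a ℓ₁} {T : Setoid b ℓ₂} →
            Inverse T S → Finite S → Finite T
transport T↔S fin = record
  { size        = size fin
  ; enumeration = Compose.inverse T↔S (Finite.enumeration fin)
  }

remove : {S : Setoid a ℓ} → Finite S → (s : Setoid.Carrier S) →
         Finite (subset S λ t → ¬ Setoid._≈_ S t s)
remove record { size = zero ; enumeration = e } s =
  contradiction (Inverse.to e s) Fin.¬Fin0
remove {S = S} record { size = suc m ; enumeration = e } s = record
  { size        = m
  ; enumeration = record
    { to        = λ (t , t≉s) → punchOut (to-≢ t≉s)
    ; from      = λ i → from (punchIn (to s) i) , from-≉ i
    ; to-cong   = λ t≈u → Fin.punchOut-cong (to s) (to-cong t≈u)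
    ; from-cong = λ { refl → S.refl }
    ; inverse   =
        (λ {i} {(t , t≉s)} t≈from-i → Fin.punchIn-injective (to s) _ _
           (≡.trans (Fin.punchIn-punchOut (to-≢ t≉s)) (inverseˡ t≈from-i)))
      , (λ { {(t , t≉s)} refl → inverseʳ (Fin.punchIn-punchOut (to-≢ t≉s)) })
    }
  }
  where
  module S = Setoid S
  open Inverse e

  to-≢ : ∀ {t} → ¬ t S.≈ s → to s ≢ to t
  to-≢ {t} t≉s eq = t≉s (S.trans (S.sym (strictlyInverseʳ t)) (inverseʳ (≡.sym eq)))

  from-≉ : ∀ i → ¬ from (punchIn (to s) i) S.≈ s
  from-≉ i eq = Fin.punchInᵢ≢i (to s) i
    (≡.trans (≡.sym (strictlyInverseˡ _)) (to-cong eq))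

size-remove : {S : Setoid a ℓ} (fin : Finite S) (s : Setoid.Carrier S) →
              suc (size (remove fin s)) ≡ size fin
size-remove record { size = zero ; enumeration = e } s =
  contradiction (Inverse.to e s) Fin.¬Fin0
size-remove record { size = suc _ } s = refl

size-mono : {S : Setoid a ℓ₁} {T : Setoid b ℓ₂} → Injection S T →
            (finS : Finite S) (finT : Finite T) → size finS ℕ.≤ size finT
size-mono S↣T finS finT = Fin.injective⇒≤ (Injection.injective
  (Compose.injection (Inverse⇒Injection (Symmetry.inverse (Finite.enumeration finS)))
    (Compose.injection S↣T (Inverse⇒Injection (Finite.enumeration finT)))))

module _ (P : Poset c ℓ₁ ℓ₂) where
  open Poset P
  open PosetProperties P using (_<_)

  [_,_] : Carrier → Carrier → Setoid _ _
  [ x , y ] = subset Eq.setoid λ z → x ≤ z × z ≤ y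

  [_,_⟩ : Carrier → Carrier → Setoid _ _
  [ x , y ⟩ = subset Eq.setoid λ z → x ≤ z × z < y

  LocallyFinite : Set _
  LocallyFinite = ∀ {x y} → x ≤ y → Finite [ x , y ]

  infix 4 _Covers_
  _Covers_ : Rel Carrier _
  z Covers y = y < z × (∀ z′ → y ≤ z′ → z′ < z → z′ ≈ y)

module MöbiusFunction (P : Poset c ℓ₁ ℓ₂) (lf : LocallyFinite P) where
  open Poset P renaming (refl to ≤-refl; trans to ≤-trans)
  open PosetProperties P using (_<_)

  private
    top : ∀ {x y} → x ≤ y → Setoid.Carrier ([_,_] P x y)
    top {y = y} x≤y = y , x≤y , ≤-refl

  finite-[_⟩ : ∀ {x y} → x ≤ y → Finite ([_,_⟩ P x y)
  finite-[ x≤y ⟩ = transport (record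
    { to        = λ (z , x≤z , z≤y , z≉y) → (z , x≤z , z≤y) , z≉y
    ; from      = λ ((z , x≤z , z≤y) , z≉y) → z , x≤z , z≤y , z≉y
    ; to-cong   = λ eq → eq
    ; from-cong = λ eq → eq
    ; inverse   = (λ eq → eq) , (λ eq → eq)
    }) (remove (lf x≤y) (top x≤y))

  size-< : ∀ {x y z} (x≤y : x ≤ y) (x≤z : x ≤ z) → z < y →
           size (lf x≤z) ℕ.< size (lf x≤y)
  size-< {x} {y} {z} x≤y x≤z (z≤y , z≉y) =
    subst (size (lf x≤z) ℕ.<_) (size-remove (lf x≤y) (top x≤y))
      (ℕ.s≤s (size-mono [x,z]↣[x,y⟩ (lf x≤z) finite-[ x≤y ⟩))
    where
    [x,z]↣[x,y⟩ : Injection ([_,_] P x z) ([_,_⟩ P x y)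
    [x,z]↣[x,y⟩ = record
      { to        = λ (w , x≤w , w≤z) → w , x≤w , ≤-trans w≤z z≤y ,
                      λ w≈y → z≉y (antisym z≤y (≤-respˡ-≈ w≈y w≤z))
      ; cong      = λ eq → eq
      ; injective = λ eq → eq
      }

  ≤⇒≈? : ∀ {x y} → x ≤ y → Dec (x ≈ y)
  ≤⇒≈? {x} x≤y = Finite._≟_ (lf x≤y) (x , ≤-refl , x≤y) (top x≤y)

  μ-acc : ∀ {x y} (x≤y : x ≤ y) → Acc ℕ._<_ (size (lf x≤y)) → ℤ
  μ-acc x≤y (acc rs) with ≤⇒≈? x≤y
  ... | yes _ = 1ℤ
  ... | no  _ = ℤ.- ∑ ℤ.+-0-commutativeMonoid finite-[ x≤y ⟩
                    λ (z , x≤z , z<y) → μ-acc x≤z (rs (size-< x≤y x≤z z<y))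

  -- μ x≤y is the value on the interval [x,y]; it is computed by
  -- well-founded recursion on the size of [x,y].
  μ : ∀ {x y} → x ≤ y → ℤ
  μ x≤y = μ-acc x≤y (<-wellFounded (size (lf x≤y)))

  private
    μ-acc-irrelevant : ∀ {x y} (x≤y : x ≤ y) (p q : Acc ℕ._<_ (size (lf x≤y))) →
                       μ-acc x≤y p ≡ μ-acc x≤y q
    μ-acc-irrelevant x≤y (acc rs) (acc rs′) with ≤⇒≈? x≤y
    ... | yes _ = refl
    ... | no  _ = cong ℤ.-_ (Sum.sum-cong-≋ ℤ.+-0-commutativeMonoid λ i →
      let (z , x≤z , z<y) = Finite.element finite-[ x≤y ⟩ i
      in μ-acc-irrelevant x≤z (rs (size-< x≤y x≤z z<y)) (rs′ (size-< x≤y x≤z z<y)))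

    μ-acc-≈ : ∀ {x y} (x≤y : x ≤ y) (p : Acc ℕ._<_ (size (lf x≤y))) →
              x ≈ y → μ-acc x≤y p ≡ 1ℤ
    μ-acc-≈ x≤y (acc rs) x≈y with ≤⇒≈? x≤y
    ... | yes _   = refl
    ... | no  x≉y = contradiction x≈y x≉y

    μ-acc-< : ∀ {x y} (x≤y : x ≤ y) (p : Acc ℕ._<_ (size (lf x≤y))) → ¬ x ≈ y →
              μ-acc x≤y p ≡ ℤ.- ∑ ℤ.+-0-commutativeMonoid finite-[ x≤y ⟩
                                  (λ (z , x≤z , z<y) → μ x≤z)
    μ-acc-< x≤y (acc rs) x≉y with ≤⇒≈? x≤y
    ... | yes x≈y = contradiction x≈y x≉y
    ... | no  _   = cong ℤ.-_ (Sum.sum-cong-≋ ℤ.+-0-commutativeMonoid λ i →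
      let (z , x≤z , z<y) = Finite.element finite-[ x≤y ⟩ i
      in μ-acc-irrelevant x≤z (rs (size-< x≤y x≤z z<y)) (<-wellFounded _))

  -- μ-≈ and μ-< are the two clauses of the usual recursive definition.
  μ-≈ : ∀ {x y} (x≤y : x ≤ y) → x ≈ y → μ x≤y ≡ 1ℤ
  μ-≈ x≤y = μ-acc-≈ x≤y (<-wellFounded (size (lf x≤y)))

  μ-< : ∀ {x y} ((x≤y , x≉y) : x < y) →
        μ x≤y ≡ ℤ.- ∑ ℤ.+-0-commutativeMonoid finite-[ x≤y ⟩
                      (λ (z , x≤z , z<y) → μ x≤z)
  μ-< (x≤y , x≉y) = μ-acc-< x≤y (<-wellFounded (size (lf x≤y))) x≉y

module MöbiusTransform (P : BoundedJoinSemilattice c ℓ₁ ℓ₂)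
                       (lf : LocallyFinite (BoundedJoinSemilattice.poset P)) where
  open BoundedJoinSemilattice P
    using (Carrier; _≤_; ⊥; minimum; poset)
  open Poset poset using (module Eq)

  support : (Carrier → ℂ) → Setoid _ _
  support f = subset Eq.setoid λ x → ¬ f x ≈ᶜ 0ᶜ

  finite-≤ : ∀ y → Finite (subset Eq.setoid (_≤ y))
  finite-≤ y = transport (record
    { to        = λ (x , x≤y) → x , minimum x , x≤y
    ; from      = λ (x , _ , x≤y) → x , x≤y
    ; to-cong   = λ eq → eq
    ; from-cong = λ eq → eq
    ; inverse   = (λ eq → eq) , (λ eq → eq)
    }) (lf (minimum y))

  möbiusTransform : (Carrier → ℂ) → Carrier → ℂ
  möbiusTransform f y = ∑ ℂ-+-commutativeMonoid (finite-≤ y) λ (x , _) → f x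

{-# OPTIONS --safe #-}
module Submission where

-- Since f(w) = Σ_{x ≤ w} μ(x,w) g(x), for a cover z of y as in (ii) the
-- terms with x ≤ y contribute - f(y) to f(z).  Any other x ≤ z satisfies
-- x ∨ y = z, so if z is not of the form x ∨ y with x in the support of g,
-- then f(z) = - f(y).  With both supports finite and f(y) ≠ 0, the covers
-- in question therefore all lie in one finite list.  Constructively this
-- makes them only not-not finite, and f(y) ≠ 0 undecided; that suffices
-- because the conclusion is negative and f(y) = 0 is double-negation stable.

open import Defs
open import Data.Integer.Base using (_*_; -_)
open import Data.Product.Base using (Σ; _×_; _,_)
open import Function.Definitions using (Congruent)
open import Relation.Binary.Bundles using (Poset)
open import Relation.Binary.Lattice.Bundles using (BoundedJoinSemilattice)
open import Relation.Binary.PropositionalEquality using (_≡_)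
open import Relation.Nullary using (¬_)

open import Algebra.Bundles using (AbelianGroup; CommutativeMonoid)
import Algebra.Construct.DirectProduct as DirectProduct
import Algebra.Properties.AbelianGroup as AbelianGroupProperties
import Algebra.Properties.CommutativeMonoid.Mult as Mult
import Algebra.Properties.CommutativeMonoid.Sum as Sum
import Algebra.Properties.CommutativeSemigroup as CommutativeSemigroupProperties
open import Data.Bool.Base using (if_then_else_)
open import Data.Fin.Base using (Fin; zero; suc; punchIn)
import Data.Fin.Properties as Fin
open import Data.Integer.Base as ℤ using (ℤ; +_; -[1+_]; 0ℤ; 1ℤ; _⊖_)
import Data.Integer.Properties as ℤ
open import Data.List.Base using (List; []; _∷_; _++_; tabulate)
import Data.List.Membership.Setoid as Membership
open import Data.List.Membership.Setoid.Properties using (∈-resp-≈; ∈-++⁺ˡ; ∈-++⁺ʳ; ∈-tabulate⁺)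
open import Data.List.Relation.Unary.Any using (any?; here; there)
open import Data.Nat.Base as ℕ using (ℕ; zero; suc)
open import Data.Nat.Induction using (<-wellFounded)
import Data.Nat.Properties as ℕ
open import Data.Product.Base using (∃; proj₁; proj₂)
open import Data.Rational.Base as ℚ using (0ℚ; ∣_∣)
import Data.Rational.Properties as ℚ
open import Data.Rational.Solver using (module +-*-Solver)
open import Data.Sum.Base using (_⊎_; inj₁; inj₂)
open import Function.Base using (_∘_; case_of_)
open import Function.Bundles using (Inverse)
open import Induction.WellFounded using (Acc; acc)
open import Level using (Level; 0ℓ)
open import Relation.Binary.Bundles using (Setoid)
open import Relation.Binary.Definitions using (Decidable)
import Relation.Binary.Lattice.Properties.JoinSemilattice as JoinProperties
import Relation.Binary.Properties.Poset as PosetProperties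
import Relation.Binary.Reasoning.Setoid as ≈-Reasoning
open import Relation.Binary.PropositionalEquality as ≡ using (_≢_; refl; cong; subst)
open import Relation.Nullary using (Dec; yes; no; does; contradiction)
open import Relation.Nullary.Decidable using (map′; _×-dec_; decidable-stable; ¬¬-excluded-middle)
open import Relation.Nullary.Negation using (¬¬-map)
open import Relation.Unary using (Pred)

private
  variable
    a c p q ℓ ℓ₁ ℓ₂ : Level
    A B : Set a

-- Finite sums in commutative monoids, and their independence of the enumeration.

module _ (M : CommutativeMonoid c ℓ) where
  open CommutativeMonoid M renaming (refl to ≈-refl; sym to ≈-sym; trans to ≈-trans)
  open Sum M
  open ≈-Reasoning setoid

  sum-ε : ∀ {n} (t : Fin n → Carrier) → (∀ i → t i ≈ ε) → sum t ≈ ε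
  sum-ε {n} t t≈ε = ≈-trans (sum-cong-≋ t≈ε) (sum-replicate-zero n)

  sum-single : ∀ {n} (t : Fin n → Carrier) i → (∀ j → j ≢ i → t j ≈ ε) → sum t ≈ t i
  sum-single {suc n} t i t≈ε = begin
    sum t                              ≈⟨ sum-remove t ⟩
    t i ∙ sum (λ j → t (punchIn i j))  ≈⟨ ∙-congˡ (sum-ε _ λ j → t≈ε _ (Fin.punchInᵢ≢i i j)) ⟩
    t i ∙ ε                            ≈⟨ identityʳ _ ⟩
    t i                                ∎

  -- `remove` renumbers by `punchIn` at the index of `s`, so this is `sum-remove` at that index.
  -- `h-cong` enters because the element stored there is only equivalent to `s`.
  ∑-remove : {S : Setoid a ℓ₁} (fin : Finite S) (s : Setoid.Carrier S)
             (h : Setoid.Carrier S → Carrier) → Congruent (Setoid._≈_ S) _≈_ h →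
             ∑ M fin h ≈ h s ∙ ∑ M (remove fin s) (h ∘ proj₁)
  ∑-remove fin@record { size = zero } s h h-cong =
    contradiction (Finite.index fin s) Fin.¬Fin0
  ∑-remove {S = S} fin@record { size = suc _ ; enumeration = e } s h h-cong = begin
    ∑ M fin h
      ≈⟨ sum-remove {i = Inverse.to e s} (h ∘ Inverse.from e) ⟩
    h (Finite.element fin (Finite.index fin s)) ∙ ∑ M (remove fin s) (h ∘ proj₁)
      ≈⟨ ∙-congʳ (h-cong (Inverse.strictlyInverseʳ e s)) ⟩
    h s ∙ ∑ M (remove fin s) (h ∘ proj₁)
      ∎

  -- An Iverson bracket: it turns a sum over matching pairs into a double sum over all pairs, whose
  -- order can be exchanged.
  guard : Dec A → Carrier → Carrier
  guard d x = if does d then x else ε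

  guard-yes : (d : Dec A) → A → ∀ {x} → guard d x ≈ x
  guard-yes (yes _) _ = ≈-refl
  guard-yes (no ¬p) p = contradiction p ¬p

  guard-no : (d : Dec A) → ¬ A → ∀ {x} → guard d x ≈ ε
  guard-no (yes p) ¬p = contradiction p ¬p
  guard-no (no _)  _  = ≈-refl

  guard-ε : (d : Dec A) → ∀ {x} → x ≈ ε → guard d x ≈ ε
  guard-ε (yes _) x≈ε = x≈ε
  guard-ε (no _)  _   = ≈-refl

  guard-cong : (d : Dec A) (e : Dec B) → (A → B) → (B → A) →
               ∀ {x y} → (A → x ≈ y) → guard d x ≈ guard e y
  guard-cong (yes p) e A→B _ x≈y = ≈-trans (x≈y p) (≈-sym (guard-yes e (A→B p)))
  guard-cong (no ¬p) e _ B→A _   = ≈-sym (guard-no e (¬p ∘ B→A))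

  module _ {S : Setoid a ℓ₁} (_≟_ : Decidable (Setoid._≈_ S)) where
    private module S = Setoid S

    -- An enumeration lists each class at most once, so at most one bracket is open. If none is, the
    -- sum is `ε`, hence the alternative `x ≈ ε`.
    ∑-guard : {V : Pred S.Carrier q} (fin : Finite (subset S V)) → ∀ s {x} →
              x ≈ ε ⊎ (∃ λ ((t , _) : ∃ V) → s S.≈ t) →
              ∑ M fin (λ (t , _) → guard (s ≟ t) x) ≈ x
    ∑-guard fin s {x} (inj₁ x≈ε) =
      ≈-trans (sum-ε _ λ i → guard-ε (s ≟ proj₁ (element i)) x≈ε) (≈-sym x≈ε)
      where open Finite fin using (element)
    ∑-guard fin s {x} (inj₂ (v , s≈v)) = begin
      ∑ M fin (λ (t , _) → guard (s ≟ t) x)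
        ≈⟨ sum-single _ (index v) (λ j j≢ → guard-no (s ≟ proj₁ (element j)) λ s≈j →
             j≢ (≡.trans (≡.sym (strictlyInverseˡ j))
                         (to-cong (S.trans (S.sym s≈j) s≈v)))) ⟩
      guard (s ≟ proj₁ (element (index v))) x
        ≈⟨ guard-yes (s ≟ _) (S.trans s≈v (S.sym (strictlyInverseʳ v))) ⟩
      x
        ∎
      where
      open Finite fin using (index; element; enumeration)
      open Inverse enumeration using (to-cong; strictlyInverseˡ; strictlyInverseʳ)

    -- Both sides equal the double sum over all pairs (u , v) with u ≈ v.
    ∑-agree : {U : Pred S.Carrier p} {V : Pred S.Carrier q}
              (finU : Finite (subset S U)) (finV : Finite (subset S V))
              {h : ∃ U → Carrier} {k : ∃ V → Carrier} →
              (∀ u v → proj₁ u S.≈ proj₁ v → h u ≈ k v) →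
              (∀ u → h u ≈ ε ⊎ (∃ λ (v : ∃ V) → proj₁ u S.≈ proj₁ v)) →
              (∀ v → k v ≈ ε ⊎ (∃ λ (u : ∃ U) → proj₁ v S.≈ proj₁ u)) →
              ∑ M finU h ≈ ∑ M finV k
    ∑-agree finU finV {h} {k} h≈k U⇒V V⇒U = begin
      ∑ M finU h
        ≈⟨ sum-cong-≋ (λ i → ≈-sym (∑-guard finV _ (U⇒V (U.element i)))) ⟩
      ∑ M finU (λ u → ∑ M finV λ v → guard (proj₁ u ≟ proj₁ v) (h u))
        ≈⟨ ∑-comm (λ i j → guard (proj₁ (U.element i) ≟ proj₁ (V.element j)) (h (U.element i))) ⟩
      ∑ M finV (λ v → ∑ M finU λ u → guard (proj₁ u ≟ proj₁ v) (h u))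
        ≈⟨ sum-cong-≋ (λ j → sum-cong-≋ λ i →
             guard-cong (_ ≟ _) (_ ≟ _) S.sym S.sym (h≈k (U.element i) (V.element j))) ⟩
      ∑ M finV (λ v → ∑ M finU λ u → guard (proj₁ v ≟ proj₁ u) (k v))
        ≈⟨ sum-cong-≋ (λ j → ∑-guard finU _ (V⇒U (V.element j))) ⟩
      ∑ M finV k
        ∎
      where
      module U = Finite finU
      module V = Finite finV

module _ (M : CommutativeMonoid c ℓ) (N : CommutativeMonoid a ℓ₁) where
  private
    module M = CommutativeMonoid M
    module N = CommutativeMonoid N

  sum-homo : (φ : M.Carrier → N.Carrier) → φ M.ε N.≈ N.ε →
             (∀ x y → φ (x M.∙ y) N.≈ φ x N.∙ φ y) →
             ∀ {n} (t : Fin n → M.Carrier) → φ (Sum.sum M t) N.≈ Sum.sum N (φ ∘ t)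
  sum-homo φ φ-ε φ-∙ {zero}  t = φ-ε
  sum-homo φ φ-ε φ-∙ {suc n} t =
    N.trans (φ-∙ _ _) (N.∙-congˡ (sum-homo φ φ-ε φ-∙ (t ∘ suc)))

-- Abelian groups as modules over the integers.

module IntegerAction (G : AbelianGroup c ℓ) where
  open AbelianGroup G renaming
    ( _∙_ to _+_; ε to 0#; _⁻¹ to ⊝_; ∙-cong to +-cong; ∙-congˡ to +-congˡ
    ; ⁻¹-cong to ⊝-cong; identityˡ to +-identityˡ; identityʳ to +-identityʳ
    ; assoc to +-assoc; comm to +-comm; inverseʳ to ⊝-inverseʳ
    ; refl to ≈-refl; sym to ≈-sym; trans to ≈-trans)
  open AbelianGroupProperties G
  open CommutativeSemigroupProperties
    (CommutativeMonoid.commutativeSemigroup commutativeMonoid) using (interchange)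
  open Mult commutativeMonoid
    using (×-congʳ; ×-homo-+; ×-homo-1) renaming (_×_ to _·ₙ_)
  open ≈-Reasoning setoid

  infixr 8 _·_
  -- Scaling by an integer Möbius value takes only repeated addition and negation, so no product of
  -- complex numbers enters.
  _·_ : ℤ → Carrier → Carrier
  (+ n)    · x = n ·ₙ x
  -[1+ n ] · x = ⊝ (suc n ·ₙ x)

  ·-congˡ : ∀ i {x y} → x ≈ y → i · x ≈ i · y
  ·-congˡ (+ n)    x≈y = ×-congʳ n x≈y
  ·-congˡ -[1+ n ] x≈y = ⊝-cong (×-congʳ (suc n) x≈y)

  ·-cong : ∀ {i j x y} → i ≡ j → x ≈ y → i · x ≈ j · y
  ·-cong {i} refl = ·-congˡ i

  ·-zeroʳ : ∀ i → i · 0# ≈ 0#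
  ·-zeroʳ (+ n)    = ·ₙ-zeroʳ n
    where
    ·ₙ-zeroʳ : ∀ n → n ·ₙ 0# ≈ 0#
    ·ₙ-zeroʳ zero    = ≈-refl
    ·ₙ-zeroʳ (suc n) = ≈-trans (+-identityˡ _) (·ₙ-zeroʳ n)
  ·-zeroʳ -[1+ n ] = ≈-trans (⊝-cong (·-zeroʳ (+ suc n))) ε⁻¹≈ε

  ·-identityˡ : ∀ x → 1ℤ · x ≈ x
  ·-identityˡ = ×-homo-1

  ·-neg : ∀ x i → (ℤ.- i) · x ≈ ⊝ (i · x)
  ·-neg x (+ zero)  = ≈-sym ε⁻¹≈ε
  ·-neg x (+ suc n) = ≈-refl
  ·-neg x -[1+ n ]  = ≈-sym (⁻¹-involutive _)

  -- Handles the mixed-sign cases of `·-homo-+`. Lowering both `m` and `n` by one fixes `m ⊖ n`,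
  -- while the right side loses only the cancelling pair `x + ⊝ x`.
  ·-⊖ : ∀ x m n → (m ⊖ n) · x ≈ m ·ₙ x + ⊝ (n ·ₙ x)
  ·-⊖ x zero    zero    = ≈-sym (⊝-inverseʳ 0#)
  ·-⊖ x zero    (suc n) = ≈-sym (+-identityˡ _)
  ·-⊖ x (suc m) zero    = ≈-sym (≈-trans (+-congˡ ε⁻¹≈ε) (+-identityʳ _))
  ·-⊖ x (suc m) (suc n) = begin
    (suc m ⊖ suc n) · x                        ≡⟨ cong (_· x) (ℤ.[1+m]⊖[1+n]≡m⊖n m n) ⟩
    (m ⊖ n) · x                                ≈⟨ ·-⊖ x m n ⟩
    m ·ₙ x + ⊝ (n ·ₙ x)                        ≈⟨ +-identityˡ _ ⟨
    0# + (m ·ₙ x + ⊝ (n ·ₙ x))                 ≈⟨ +-cong (⊝-inverseʳ x) ≈-refl ⟨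
    (x + ⊝ x) + (m ·ₙ x + ⊝ (n ·ₙ x))          ≈⟨ interchange x (⊝ x) _ _ ⟩
    (x + m ·ₙ x) + (⊝ x + ⊝ (n ·ₙ x))          ≈⟨ +-congˡ (⁻¹-∙-comm x _) ⟩
    (x + m ·ₙ x) + ⊝ (x + n ·ₙ x)              ∎

  ·-homo-+ : ∀ x i j → (i ℤ.+ j) · x ≈ i · x + j · x
  ·-homo-+ x (+ m)    (+ n)    = ×-homo-+ x m n
  ·-homo-+ x (+ m)    -[1+ n ] = ·-⊖ x m (suc n)
  ·-homo-+ x -[1+ m ] (+ n)    = ≈-trans (·-⊖ x n (suc m)) (+-comm _ _)
  ·-homo-+ x -[1+ m ] -[1+ n ] = begin
    ⊝ (suc (suc (m ℕ.+ n)) ·ₙ x)       ≡⟨ cong (λ k → ⊝ (suc k ·ₙ x)) (ℕ.+-suc m n) ⟨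
    ⊝ ((suc m ℕ.+ suc n) ·ₙ x)         ≈⟨ ⊝-cong (×-homo-+ x (suc m) (suc n)) ⟩
    ⊝ (suc m ·ₙ x + suc n ·ₙ x)        ≈⟨ ⁻¹-∙-comm _ _ ⟨
    ⊝ (suc m ·ₙ x) + ⊝ (suc n ·ₙ x)    ∎

  module _ {S : Setoid a ℓ₁} (fin : Finite S) where
    ∑-· : (t : Setoid.Carrier S → ℤ) (x : Carrier) →
          ∑ ℤ.+-0-commutativeMonoid fin t · x ≈ ∑ commutativeMonoid fin (λ s → t s · x)
    ∑-· t x = sum-homo ℤ.+-0-commutativeMonoid commutativeMonoid (_· x) ≈-refl (·-homo-+ x)
      (t ∘ Finite.element fin)

    ∑-neg : (h : Setoid.Carrier S → Carrier) →
            ⊝ ∑ commutativeMonoid fin h ≈ ∑ commutativeMonoid fin (λ s → ⊝ h s)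
    ∑-neg h = sum-homo commutativeMonoid commutativeMonoid ⊝_ ε⁻¹≈ε
      (λ x y → ≈-sym (⁻¹-∙-comm x y)) (h ∘ Finite.element fin)

-- Subsets covered by a list, and their finiteness up to double negation.

module _ {S : Setoid a ℓ} (_≟_ : Decidable (Setoid._≈_ S)) where
  open Setoid S renaming (refl to ≈-refl; sym to ≈-sym; trans to ≈-trans)
  open Membership S using (_∈_)

  -- Puts the class of `s` back: it takes index zero, and deciding `t ≟ s` sends every other element
  -- to `fin`.
  insert : {U : Pred Carrier p} (s : ∃ U) →
           Finite (subset S λ t → U t × ¬ t ≈ proj₁ s) → Finite (subset S U)
  insert {U = U} (s , Us) fin = record
    { size        = suc (Finite.size fin)
    ; enumeration = record
      { to        = to
      ; from      = from
      ; to-cong   = λ {t} {u} → to-cong t u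
      ; from-cong = λ { refl → ≈-refl }
      ; inverse   = (λ {i} {t} → inverseˡ i t) , λ { {t} refl → inverseʳ t }
      }
    }
    where
    open Finite fin using (index; element; enumeration)
    module E = Inverse enumeration

    to : ∃ U → Fin _
    to (t , Ut) with t ≟ s
    ... | yes _  = zero
    ... | no t≉s = suc (index (t , Ut , t≉s))

    from : Fin _ → ∃ U
    from zero    = s , Us
    from (suc i) = let t , Ut , _ = element i in t , Ut

    to-cong : ∀ t u → proj₁ t ≈ proj₁ u → to t ≡ to u
    to-cong (t , _) (u , _) t≈u with t ≟ s | u ≟ s
    ... | yes _   | yes _   = refl
    ... | yes t≈s | no u≉s  = contradiction (≈-trans (≈-sym t≈u) t≈s) u≉s
    ... | no t≉s  | yes u≈s = contradiction (≈-trans t≈u u≈s) t≉s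
    ... | no _    | no _    = cong suc (E.to-cong t≈u)

    inverseˡ : ∀ i t → proj₁ t ≈ proj₁ (from i) → to t ≡ i
    inverseˡ i (t , _) t≈i with t ≟ s
    inverseˡ zero    _ _   | yes _   = refl
    inverseˡ zero    _ t≈s | no t≉s  = contradiction t≈s t≉s
    inverseˡ (suc i) _ t≈i | yes t≈s =
      contradiction (≈-trans (≈-sym t≈i) t≈s) (proj₂ (proj₂ (element i)))
    inverseˡ (suc i) _ t≈i | no _    = cong suc (E.inverseˡ t≈i)

    inverseʳ : ∀ t → proj₁ (from (to t)) ≈ proj₁ t
    inverseʳ (t , Ut) with t ≟ s
    ... | yes t≈s = ≈-sym t≈s
    ... | no t≉s  = E.strictlyInverseʳ (t , Ut , t≉s)

  -- Induction on the list. Whether `U` meets the class of the head is undecided, but the goal is a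
  -- negation, so excluded middle may be assumed for this one question. If `U` meets the class, the
  -- tail covers the rest of `U` and `insert` restores the class; if not, the tail already covers
  -- `U`.
  covered⇒¬infinite : {U : Pred Carrier p} (xs : List Carrier) →
                      (∀ t → U t → t ∈ xs) → ¬ Infinite (subset S U)
  covered⇒¬infinite {U = U} [] U⊆xs ¬fin = ¬fin record
    { size        = 0
    ; enumeration = record
      { to        = λ (t , Ut) → contradiction (U⊆xs t Ut) λ ()
      ; from      = λ ()
      ; to-cong   = λ { {t , Ut} → contradiction (U⊆xs t Ut) λ () }
      ; from-cong = λ { {()} }
      ; inverse   = (λ { {()} }) , λ { {t , Ut} → contradiction (U⊆xs t Ut) λ () }
      }
    }
  covered⇒¬infinite {U = U} (x ∷ xs) U⊆x∷xs ¬fin = ¬¬-excluded-middle {A = ∃ λ (s : ∃ U) → proj₁ s ≈ x} λ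
    { (yes ((s , Us) , s≈x)) →
      covered⇒¬infinite xs
        (λ t (Ut , t≉s) → drop t (λ t≈x → t≉s (≈-trans t≈x (≈-sym s≈x))) (U⊆x∷xs t Ut))
        (¬fin ∘ insert (s , Us))
    ; (no ∄s) →
      covered⇒¬infinite xs
        (λ t Ut → drop t (λ t≈x → ∄s ((t , Ut) , t≈x)) (U⊆x∷xs t Ut))
        ¬fin
    }
    where
    drop : ∀ t → ¬ t ≈ x → t ∈ x ∷ xs → t ∈ xs
    drop t t≉x (here t≈x)   = contradiction t≈x t≉x
    drop t t≉x (there t∈xs) = t∈xs

-- The Möbius function on a locally finite join-semilattice.

module _ (P : BoundedJoinSemilattice c ℓ₁ ℓ₂)
         (lf : LocallyFinite (BoundedJoinSemilattice.poset P)) where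
  open BoundedJoinSemilattice P hiding (module Eq)
    renaming (refl to ≤-refl; trans to ≤-trans)
  open Poset poset using (module Eq)
  open PosetProperties poset using (_<_)
  open MöbiusFunction poset lf
  open MöbiusTransform P lf
  open JoinProperties joinSemilattice using (∨-cong)

  -- Local finiteness gives decidability of ≈ on intervals only; the
  -- join brings x ≤ y into the interval [ y , x ∨ y ].
  _≤?_ : Decidable _≤_
  x ≤? y = map′
    (λ y≈x∨y → ≤-trans (x≤x∨y x y) (reflexive (Eq.sym y≈x∨y)))
    (λ x≤y → antisym (y≤x∨y x y) (∨-least x≤y ≤-refl))
    (≤⇒≈? (y≤x∨y x y))

  _≈?_ : Decidable _≈_
  x ≈? y = map′ (λ (x≤y , y≤x) → antisym x≤y y≤x)
                (λ x≈y → reflexive x≈y , reflexive (Eq.sym x≈y))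
                (x ≤? y ×-dec y ≤? x)

  private
    <-respʳ-≈ : ∀ {x y z} → y ≈ z → x < y → x < z
    <-respʳ-≈ y≈z (x≤y , x≉y) =
      ≤-trans x≤y (reflexive y≈z) , λ x≈z → x≉y (Eq.trans x≈z (Eq.sym y≈z))

    -- For different endpoints or order proofs `lf` may give different enumerations, so the
    -- recursive sums cannot be compared index by index. `∑-agree` compares them by element, with
    -- induction on the interval size for the terms.
    μ-cong-acc : ∀ {x x′ y y′} (x≤y : x ≤ y) (x′≤y′ : x′ ≤ y′) →
                 Acc ℕ._<_ (Finite.size (lf x≤y)) → x ≈ x′ → y ≈ y′ → μ x≤y ≡ μ x′≤y′
    μ-cong-acc x≤y x′≤y′ (acc rs) x≈x′ y≈y′ = case ≤⇒≈? x≤y of λ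
      { (yes x≈y) → ≡.trans (μ-≈ x≤y x≈y)
          (≡.sym (μ-≈ x′≤y′ (Eq.trans (Eq.sym x≈x′) (Eq.trans x≈y y≈y′))))
      ; (no x≉y) → ≡.trans (μ-< (x≤y , x≉y)) (≡.trans
          (cong ℤ.-_ (∑-agree ℤ.+-0-commutativeMonoid _≈?_ finite-[ x≤y ⟩ finite-[ x′≤y′ ⟩
            (λ (_ , x≤z , z<y) (_ , x′≤z′ , _) →
              μ-cong-acc x≤z x′≤z′ (rs (size-< x≤y x≤z z<y)) x≈x′)
            (λ (z , x≤z , z<y) →
              inj₂ ((z , ≤-trans (reflexive (Eq.sym x≈x′)) x≤z , <-respʳ-≈ y≈y′ z<y) , Eq.refl))
            (λ (z , x′≤z , z<y′) →
              inj₂ ((z , ≤-trans (reflexive x≈x′) x′≤z , <-respʳ-≈ (Eq.sym y≈y′) z<y′) , Eq.refl))))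
          (≡.sym (μ-< (x′≤y′ , λ x′≈y′ →
            x≉y (Eq.trans x≈x′ (Eq.trans x′≈y′ (Eq.sym y≈y′)))))))
      }

  μ-cong : ∀ {x x′ y y′} (x≤y : x ≤ y) (x′≤y′ : x′ ≤ y′) →
           x ≈ x′ → y ≈ y′ → μ x≤y ≡ μ x′≤y′
  μ-cong x≤y x′≤y′ = μ-cong-acc x≤y x′≤y′ (<-wellFounded _)

  -- Extension of `μ` by zero to all pairs. It gives the sums in the inversion proof a common index
  -- set, so that they can be exchanged.
  μ₀ : Carrier → Carrier → ℤ
  μ₀ x y with x ≤? y
  ... | yes x≤y = μ x≤y
  ... | no  _   = 0ℤ

  μ₀-≤ : ∀ {x y} (x≤y : x ≤ y) → μ₀ x y ≡ μ x≤y
  μ₀-≤ {x} {y} x≤y with x ≤? y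
  ... | yes x≤y′ = μ-cong x≤y′ x≤y Eq.refl Eq.refl
  ... | no  x≰y  = contradiction x≤y x≰y

  -- The recursion for `μ` sums over `z` from `x` upwards; widening the range down to the bottom
  -- element adds only zero terms.
  μ₀-< : ∀ {x y} → x < y →
         μ₀ x y ≡ ℤ.- ∑ ℤ.+-0-commutativeMonoid finite-[ minimum y ⟩ (λ (z , _) → μ₀ x z)
  μ₀-< {x} {y} x<y@(x≤y , _) = ≡.trans (≡.trans (μ₀-≤ x≤y) (μ-< x<y))
    (cong ℤ.-_ (∑-agree ℤ.+-0-commutativeMonoid _≈?_ finite-[ x≤y ⟩ finite-[ minimum y ⟩
      (λ (_ , x≤z , _) (_ , _) z≈z′ →
        let x≤z′ = ≤-trans x≤z (reflexive z≈z′)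
        in ≡.trans (μ-cong x≤z x≤z′ Eq.refl z≈z′) (≡.sym (μ₀-≤ x≤z′)))
      (λ (z , _ , z<y) → inj₂ ((z , minimum z , z<y) , Eq.refl))
      below))
    where
    below : ∀ v → μ₀ x (proj₁ v) ≡ 0ℤ ⊎ _
    below (z , _ , z<y) with x ≤? z
    ... | yes x≤z = inj₂ ((z , x≤z , z<y) , Eq.refl)
    ... | no  x≰z = inj₁ refl

  -- Möbius inversion with values in an abelian group, and its consequences at covers.

  module _ (G : AbelianGroup a ℓ) where
    private module G = AbelianGroup G
    open G using () renaming
      ( Carrier to M; _≈_ to _≈ᴹ_; _∙_ to _+_; ε to 0#; _⁻¹ to ⊝_
      ; commutativeMonoid to +-commutativeMonoid )
    open IntegerAction G
    open AbelianGroupProperties G using (//-rightDividesʳ; ε⁻¹≈ε; ⁻¹-involutive)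
    open Sum +-commutativeMonoid using (sum-cong-≋; ∑-comm)
    open ≈-Reasoning G.setoid

    private
      ∑ᴹ : {S : Setoid p q} → Finite S → (Setoid.Carrier S → M) → M
      ∑ᴹ = ∑ +-commutativeMonoid

    -- Both enumerations come from `lf (minimum w)`, the second by removing the top, so `∑-remove`
    -- applies directly.
    ∑-split-top : ∀ w (h : ∃ (_≤ w) → M) → (∀ u v → proj₁ u ≈ proj₁ v → h u ≈ᴹ h v) →
                  ∑ᴹ (finite-≤ w) h ≈ᴹ
                  h (w , ≤-refl) +
                  ∑ᴹ finite-[ minimum w ⟩ (λ (x , _ , x≤w , _) → h (x , x≤w))
    ∑-split-top w h h-cong =
      ∑-remove +-commutativeMonoid (lf (minimum w)) (w , minimum w , ≤-refl)
        (λ (x , _ , x≤w) → h (x , x≤w)) (λ x≈y → h-cong _ _ x≈y)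

    module _ (f : Carrier → M) (f-cong : Congruent _≈_ _≈ᴹ_ f) where

      transform : Carrier → M
      transform y = ∑ᴹ (finite-≤ y) λ (x , _) → f x

      transform-cong : Congruent _≈_ _≈ᴹ_ transform
      transform-cong {y} {z} y≈z =
        ∑-agree +-commutativeMonoid _≈?_ (finite-≤ y) (finite-≤ z)
          (λ _ _ → f-cong)
          (λ (x , x≤y) → inj₂ ((x , ≤-trans x≤y (reflexive y≈z)) , Eq.refl))
          (λ (x , x≤z) → inj₂ ((x , ≤-trans x≤z (reflexive (Eq.sym y≈z))) , Eq.refl))

      private
        g = transform

        μg-cong : ∀ w (u v : ∃ (_≤ w)) → proj₁ u ≈ proj₁ v →
                  μ (proj₂ u) · g (proj₁ u) ≈ᴹ μ (proj₂ v) · g (proj₁ v)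
        μg-cong w (_ , u≤w) (_ , v≤w) u≈v =
          ·-cong (μ-cong u≤w v≤w u≈v Eq.refl) (transform-cong u≈v)

        -- Strong induction on the size of the interval from bottom to `w`. The top term is `g w`.
        -- In the others the recursion for `μ` and an exchange of sums produce minus the inversion
        -- sums at all `v < w`, which equal `f v` by induction. Subtracting these from `g w` leaves
        -- `f w`.
        inversion-acc : ∀ w → Acc ℕ._<_ (Finite.size (lf (minimum w))) →
                        ∑ᴹ (finite-≤ w) (λ (x , x≤w) → μ x≤w · g x) ≈ᴹ f w
        inversion-acc w (acc rs) = begin
          ∑ᴹ (finite-≤ w) (λ (x , x≤w) → μ x≤w · g x)
            ≈⟨ ∑-split-top w _ (μg-cong w) ⟩
          μ (≤-refl {w}) · g w + ∑ᴹ W (λ (x , _ , x≤w , _) → μ x≤w · g x)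
            ≈⟨ G.∙-cong (G.trans (·-cong (μ-≈ ≤-refl Eq.refl) G.refl) (·-identityˡ _)) proper ⟩
          g w + ⊝ ∑ᴹ W (λ (v , _) → f v)
            ≈⟨ G.∙-congʳ (∑-split-top w (λ (x , _) → f x) (λ _ _ → f-cong)) ⟩
          f w + ∑ᴹ W (λ (v , _) → f v) + ⊝ ∑ᴹ W (λ (v , _) → f v)
            ≈⟨ //-rightDividesʳ _ (f w) ⟩
          f w
            ∎
          where
          W = finite-[ minimum w ⟩
          open Finite W using (element)

          row : ∀ x → x < w → μ₀ x w · g x ≈ᴹ ⊝ ∑ᴹ W (λ (v , _) → μ₀ x v · g x)
          row x x<w = begin
            μ₀ x w · g x
              ≈⟨ ·-cong (μ₀-< x<w) G.refl ⟩
            (ℤ.- ∑ ℤ.+-0-commutativeMonoid W (λ (v , _) → μ₀ x v)) · g x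
              ≈⟨ ·-neg (g x) (∑ ℤ.+-0-commutativeMonoid W (λ (v , _) → μ₀ x v)) ⟩
            ⊝ (∑ ℤ.+-0-commutativeMonoid W (λ (v , _) → μ₀ x v) · g x)
              ≈⟨ G.⁻¹-cong (∑-· W (λ (v , _) → μ₀ x v) (g x)) ⟩
            ⊝ ∑ᴹ W (λ (v , _) → μ₀ x v · g x)
              ∎

          -- Every `x ≤ v` lies strictly below `w`, and the remaining `x` have `μ₀ x v` zero, so
          -- this is the inversion sum at `v`.
          column : ∀ v → v < w → ∑ᴹ W (λ (x , _) → μ₀ x v · g x) ≈ᴹ f v
          column v v<w@(v≤w , v≉w) = begin
            ∑ᴹ W (λ (x , _) → μ₀ x v · g x)
              ≈⟨ ∑-agree +-commutativeMonoid _≈?_ (finite-≤ v) W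
                   (λ (_ , x≤v) _ x≈y →
                     let y≤v = ≤-trans (reflexive (Eq.sym x≈y)) x≤v
                     in ·-cong (≡.trans (μ-cong x≤v y≤v x≈y Eq.refl) (≡.sym (μ₀-≤ y≤v)))
                               (transform-cong x≈y))
                   (λ (x , x≤v) → inj₂ ((x , minimum x , ≤-trans x≤v v≤w ,
                     λ x≈w → v≉w (antisym v≤w (≤-trans (reflexive (Eq.sym x≈w)) x≤v))) , Eq.refl))
                   outside ⟨
            ∑ᴹ (finite-≤ v) (λ (x , x≤v) → μ x≤v · g x)
              ≈⟨ inversion-acc v (rs (size-< (minimum w) (minimum v) v<w)) ⟩
            f v
              ∎
            where
            outside : ∀ u → μ₀ (proj₁ u) v · g (proj₁ u) ≈ᴹ 0# ⊎ _
            outside (x , _) with x ≤? v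
            ... | yes x≤v = inj₂ ((x , x≤v) , Eq.refl)
            ... | no  x≰v = inj₁ G.refl

          proper : ∑ᴹ W (λ (x , _ , x≤w , _) → μ x≤w · g x) ≈ᴹ ⊝ ∑ᴹ W (λ (v , _) → f v)
          proper = begin
            ∑ᴹ W (λ (x , _ , x≤w , _) → μ x≤w · g x)
              ≈⟨ sum-cong-≋ (λ i → let x , _ , x<w@(x≤w , _) = element i in
                   G.trans (·-cong (≡.sym (μ₀-≤ x≤w)) G.refl) (row x x<w)) ⟩
            ∑ᴹ W (λ (x , _) → ⊝ ∑ᴹ W (λ (v , _) → μ₀ x v · g x))
              ≈⟨ ∑-neg W (λ (x , _) → ∑ᴹ W (λ (v , _) → μ₀ x v · g x)) ⟨
            ⊝ ∑ᴹ W (λ (x , _) → ∑ᴹ W (λ (v , _) → μ₀ x v · g x))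
              -- Both indices range over all of `W` because `μ₀` absorbs the condition `x ≤ v`.
              ≈⟨ G.⁻¹-cong (∑-comm λ i j →
                   μ₀ (proj₁ (element i)) (proj₁ (element j)) · g (proj₁ (element i))) ⟩
            ⊝ ∑ᴹ W (λ (v , _) → ∑ᴹ W (λ (x , _) → μ₀ x v · g x))
              ≈⟨ G.⁻¹-cong (sum-cong-≋ λ i →
                   let v , _ , v<w = element i in column v v<w) ⟩
            ⊝ ∑ᴹ W (λ (v , _) → f v)
              ∎

      möbius-inversion : ∀ w → f w ≈ᴹ
        ∑ᴹ (finite-≤ w) (λ (x , x≤w) → μ x≤w · transform x)
      möbius-inversion w = G.sym (inversion-acc w (<-wellFounded _))

      -- In the inversion sum at `z`, terms with `x ≤ y` are the negatives of those at `y`, and all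
      -- others vanish with `transform`.
      negated-at-cover : ∀ {y z} (y≤z : y ≤ z) →
                      (∀ {x} (x≤y : x ≤ y) → μ (≤-trans x≤y y≤z) ≡ ℤ.- μ x≤y) →
                      (∀ {x} → x ≤ z → ¬ x ≤ y → transform x ≈ᴹ 0#) →
                      f z ≈ᴹ ⊝ f y
      negated-at-cover {y} {z} y≤z μ-antisym g≈0 = begin
        f z
          ≈⟨ möbius-inversion z ⟩
        ∑ᴹ (finite-≤ z) (λ (x , x≤z) → μ x≤z · g x)
          ≈⟨ ∑-agree +-commutativeMonoid _≈?_ (finite-≤ z) (finite-≤ y)
               (λ (x , x≤z) (v , v≤y) x≈v →
                 G.trans (·-cong (≡.trans (μ-cong x≤z (≤-trans v≤y y≤z) x≈v Eq.refl) (μ-antisym v≤y))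
                                 (transform-cong x≈v))
                         (·-neg (g v) (μ v≤y)))
               outside
               (λ (x , x≤y) → inj₂ ((x , ≤-trans x≤y y≤z) , Eq.refl)) ⟩
        ∑ᴹ (finite-≤ y) (λ (x , x≤y) → ⊝ (μ x≤y · g x))
          ≈⟨ ∑-neg (finite-≤ y) (λ (x , x≤y) → μ x≤y · g x) ⟨
        ⊝ ∑ᴹ (finite-≤ y) (λ (x , x≤y) → μ x≤y · g x)
          ≈⟨ G.⁻¹-cong (möbius-inversion y) ⟨
        ⊝ f y
          ∎
        where
        outside : ∀ u → μ (proj₂ u) · g (proj₁ u) ≈ᴹ 0# ⊎ _
        outside (x , x≤z) with x ≤? y
        ... | yes x≤y = inj₂ ((x , x≤y) , Eq.refl)
        ... | no  x≰y = inj₁ (G.trans (·-congˡ (μ x≤z) (g≈0 x≤z x≰y)) (·-zeroʳ (μ x≤z)))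

      -- Stability reduces the goal to refuting `f y ≠ 0`; under that assumption one list contains
      -- every cover supplied by the hypothesis, against their infinitude.
      finite-supports⇒vanishing :
        (∀ m → ¬ ¬ m ≈ᴹ 0# → m ≈ᴹ 0#) →
        (∀ y → Infinite (subset Eq.setoid λ z →
           Σ (_Covers_ poset z y) λ ((y≤z , _) , _) →
             ∀ {x} (x≤y : x ≤ y) →
               μ (≤-trans x≤y y≤z) ≡ μ x≤y * μ y≤z ×
               μ x≤y * μ y≤z ≡ - μ x≤y)) →
        Finite (subset Eq.setoid λ x → ¬ f x ≈ᴹ 0#) →
        Finite (subset Eq.setoid λ x → ¬ transform x ≈ᴹ 0#) →
        ∀ x → f x ≈ᴹ 0#
      finite-supports⇒vanishing stable infinite finF finG y = stable (f y) λ fy≉0 →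
        covered⇒¬infinite _≈?_ (joins ++ points) 
          (λ z (covers , μ-mult) → covered fy≉0 z
            (covers , λ x≤y → let eq , eq′ = μ-mult x≤y in ≡.trans eq eq′))
          (infinite y)
        where
        module F = Finite finF
        module T = Finite finG
        open Membership Eq.setoid using (_∈_)

        -- The two possibilities for a cover `z`: it is `x ∨ y` with `x` in the support of `g`, or
        -- it lies in the support of `f`.
        joins points : List Carrier
        joins  = tabulate λ i → proj₁ (T.element i) ∨ y
        points = tabulate λ i → proj₁ (F.element i)

        ∈-joins : ∀ {x z} → ¬ g x ≈ᴹ 0# → x ∨ y ≈ z → z ∈ joins
        ∈-joins {x} gx≉0 x∨y≈z = ∈-resp-≈ Eq.setoid
          (Eq.trans (∨-cong (Inverse.strictlyInverseʳ T.enumeration (x , gx≉0)) Eq.refl) x∨y≈z)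
          (∈-tabulate⁺ Eq.setoid (T.index (x , gx≉0)))

        ∈-points : ∀ {z} → ¬ f z ≈ᴹ 0# → z ∈ points
        ∈-points {z} fz≉0 = ∈-resp-≈ Eq.setoid
          (Inverse.strictlyInverseʳ F.enumeration (z , fz≉0))
          (∈-tabulate⁺ Eq.setoid (F.index (z , fz≉0)))

        -- Membership in `joins` is decidable. Outside it, `f z` is minus `f y`, so `f z` vanishing
        -- would force `f y` to vanish.
        covered : ¬ f y ≈ᴹ 0# → ∀ z →
                  (Σ (_Covers_ poset z y) λ ((y≤z , _) , _) →
                     ∀ {x} (x≤y : x ≤ y) → μ (≤-trans x≤y y≤z) ≡ ℤ.- μ x≤y) →
                  z ∈ joins ++ points
        covered fy≉0 z (((y≤z , _) , no-between) , μ-antisym) with any? (z ≈?_) joins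
        ... | yes z∈joins = ∈-++⁺ˡ Eq.setoid z∈joins
        ... | no  z∉joins = ∈-++⁺ʳ Eq.setoid joins (∈-points λ fz≈0 → fy≉0 (begin
          f y        ≈⟨ ⁻¹-involutive (f y) ⟨
          ⊝ (⊝ f y)  ≈⟨ G.⁻¹-cong (negated-at-cover y≤z μ-antisym g≈0) ⟨
          ⊝ f z      ≈⟨ G.⁻¹-cong fz≈0 ⟩
          ⊝ 0#       ≈⟨ ε⁻¹≈ε ⟩
          0#         ∎))
          where
          -- The join lies between `y` and `z`. Were it different from `z`, the covering property
          -- would make it equal to `y`, giving `x ≤ y`.
          x∨y≈z : ∀ {x} → x ≤ z → ¬ x ≤ y → x ∨ y ≈ z
          x∨y≈z {x} x≤z x≰y = decidable-stable ((x ∨ y) ≈? z) λ x∨y≉z →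
            x≰y (≤-trans (x≤x∨y x y) (reflexive
              (no-between (x ∨ y) (y≤x∨y x y) (∨-least x≤z y≤z , x∨y≉z))))

          g≈0 : ∀ {x} → x ≤ z → ¬ x ≤ y → g x ≈ᴹ 0#
          g≈0 {x} x≤z x≰y = stable (g x) λ gx≉0 → z∉joins (∈-joins gx≉0 (x∨y≈z x≤z x≰y))

-- The additive groups of real and complex numbers, and stability of being zero.

private
  zero-difference : ∀ {x y ε} → x ≡ y → 0ℚ ℚ.< ε → ∣ x ℚ.- y ∣ ℚ.< ε
  zero-difference {x} {ε = ε} refl = subst (λ q → ∣ q ∣ ℚ.< ε) (≡.sym (ℚ.+-inverseʳ x))

  neg-difference : ∀ x y → ∣ ℚ.- x ℚ.- ℚ.- y ∣ ≡ ∣ x ℚ.- y ∣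
  neg-difference x y = ≡.trans
    (cong ∣_∣ (solve 2 (λ x y → :- x :- :- y := :- (x :- y)) refl x y))
    (ℚ.∣-p∣≡∣p∣ (x ℚ.- y))
    where open +-*-Solver

open ℝ

-ᵣ_ : ℝ → ℝ
-ᵣ x = mkℝ (λ n → ℚ.- seq x n) λ ε ε>0 →
  let N , h = cauchy x ε ε>0
  in N , λ m n N≤m N≤n →
     subst (ℚ._< ε) (≡.sym (neg-difference (seq x m) (seq x n))) (h m n N≤m N≤n)

ℝ-+-abelianGroup : AbelianGroup 0ℓ 0ℓ
ℝ-+-abelianGroup = record
  { _⁻¹ = -ᵣ_
  ; isAbelianGroup = record
    { isGroup = record
      { isMonoid = CommutativeMonoid.isMonoid ℝ-+-commutativeMonoid
      ; inverse  =
          (λ x ε ε>0 → 0 , λ n _ → zero-difference (ℚ.+-inverseˡ (seq x n)) ε>0)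
        , (λ x ε ε>0 → 0 , λ n _ → zero-difference (ℚ.+-inverseʳ (seq x n)) ε>0)
      ; ⁻¹-cong  = λ {x} {y} x≈y ε ε>0 →
          let N , h = x≈y ε ε>0
          in N , λ n N≤n →
             subst (ℚ._< ε) (≡.sym (neg-difference (seq x n) (seq y n))) (h n N≤n)
      }
    ; comm = CommutativeMonoid.comm ℝ-+-commutativeMonoid
    }
  }

-- Built over the same monoid structure as `ℂ-+-commutativeMonoid`, so that `transform` for this
-- group is `möbiusTransform` by definition.
ℂ-+-abelianGroup : AbelianGroup 0ℓ 0ℓ
ℂ-+-abelianGroup = DirectProduct.abelianGroup ℝ-+-abelianGroup ℝ-+-abelianGroup

-- The Cauchy modulus bounds the tail by its value at one late index,
-- where the inequality to be shown is decidable.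
≈0ᵣ-stable : ∀ x → ¬ ¬ x ≈ᵣ 0ᵣ → x ≈ᵣ 0ᵣ
≈0ᵣ-stable x ¬¬x≈0 ε ε>0 =
  let δ , δ>0 , δ<ε = ℚ.<-dense ε>0
      N , h = cauchy x δ δ>0
      ε-δ>0 = subst (ℚ._< ε ℚ.- δ) (ℚ.+-inverseʳ δ) (ℚ.+-monoˡ-< (ℚ.- δ) δ<ε)
  in N , λ n N≤n → decidable-stable (_ ℚ.<? ε) λ xₙ≮ε → ¬¬x≈0 λ x≈0 →
     let N′ , h′ = x≈0 (ε ℚ.- δ) ε-δ>0
         m = N ℕ.⊔ N′
     in xₙ≮ε (begin-strict
       ∣ seq x n ℚ.- 0ℚ ∣
         ≡⟨ cong ∣_∣ (telescope (seq x n) (seq x m) 0ℚ) ⟨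
       ∣ (seq x n ℚ.- seq x m) ℚ.+ (seq x m ℚ.- 0ℚ) ∣
         ≤⟨ ℚ.∣p+q∣≤∣p∣+∣q∣ (seq x n ℚ.- seq x m) (seq x m ℚ.- 0ℚ) ⟩
       ∣ seq x n ℚ.- seq x m ∣ ℚ.+ ∣ seq x m ℚ.- 0ℚ ∣
         <⟨ ℚ.+-mono-< (h n m N≤n (ℕ.m≤m⊔n N N′)) (h′ m (ℕ.m≤n⊔m N N′)) ⟩
       δ ℚ.+ (ε ℚ.- δ)
         ≡⟨ solve 2 (λ δ ε → δ :+ (ε :- δ) := ε) refl δ ε ⟩
       ε
         ∎)
  where
  open ℚ.≤-Reasoning
  open +-*-Solver

  telescope : ∀ x y z → (x ℚ.- y) ℚ.+ (y ℚ.- z) ≡ x ℚ.- z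
  telescope = solve 3 (λ x y z → (x :- y) :+ (y :- z) := x :- z) refl

≈0ᶜ-stable : ∀ z → ¬ ¬ z ≈ᶜ 0ᶜ → z ≈ᶜ 0ᶜ
≈0ᶜ-stable (x , y) ¬¬z≈0 =
  ≈0ᵣ-stable x (¬¬-map proj₁ ¬¬z≈0) , ≈0ᵣ-stable y (¬¬-map proj₂ ¬¬z≈0)

theorem2p1 :
    ∀ {c ℓ₁ ℓ₂} (P : BoundedJoinSemilattice c ℓ₁ ℓ₂) →
    let open BoundedJoinSemilattice P in
    (lf : LocallyFinite poset) →
    let open MöbiusFunction poset lf
        open MöbiusTransform P lf in
    (∀ y → Infinite (subset (Poset.Eq.setoid poset) λ z →
       Σ (_Covers_ poset z y) λ ((y≤z , _) , _) →
         ∀ {x} (x≤y : x ≤ y) →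
           μ (trans x≤y y≤z) ≡ μ x≤y * μ y≤z ×
           μ x≤y * μ y≤z ≡ - μ x≤y)) →
    (f : Carrier → ℂ) → Congruent _≈_ _≈ᶜ_ f →
    ¬ (∀ x → f x ≈ᶜ 0ᶜ) →
    ¬ (Finite (support f) × Finite (support (möbiusTransform f)))
theorem2p1 P lf infinite f f-cong f≉0 (finF , finG) =
  f≉0 (finite-supports⇒vanishing P lf ℂ-+-abelianGroup f f-cong ≈0ᶜ-stable
    infinite finF finG)
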